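{- Let $K\ge1$ and let $G_1,G_2,\ldots,G_K$ be mutually disjoint graphs. Then for every $n\in\mathbb{N}$, $$\mathcal{M}_n(G_1\sqcup\cdots\sqcup G_K)=\sum_{j=1}^K\frac{\alpha_j}{\alpha}\,\mathcal{M}_n(G_j),$$ where $\alpha_j$ is the number of vertices of $G_j$ and $\alpha=\alpha_1+\cdots+\alpha_K$.
   Context: Graphs are finite, undirected, without loops (and simple), with nonempty vertex set; $\mathbb{N}=\{0,1,2,\ldots\}$. For graphs with disjoint vertex sets, $G_1\sqcup G_2=(V_1\cup V_2,E_1\cup E_2)$ is the direct sum (disjoint union), and similarly for $K$ graphs. For a graph $G$ on $N$ vertices with adjacency matrix $A$, put $e=1_N/\|1_N\|_2$ with $1_N$ the all-ones column vector in $\mathbb{C}^N$, and $\varphi_e(B)=\langle e,Be\rangle$ for $N\times N$ complex matrices $B$. The moment matrix $\mathcal{M}_n(G)$ of degree $n$ is the $(n+1)\times(n+1)$ matrix with $(i,j)$ entry $\varphi_e(A^{i+j})$, $0\le i,j\le n$ (it does not depend on the ordering of the vertices). -}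

module Defs where

open import Algebra.Bundles.Raw using (RawMonoid; RawRing)
import Algebra.Definitions.RawMonoid as RawMonoidSum
open import Data.Bool.Base using (if_then_else_)
open import Data.Fin.Base using (Fin; zero; suc; toℕ)
import Data.Fin.Properties as Fin
open import Data.Integer.Base as ℤ using (+_; -[1+_])
import Data.Integer.Properties as ℤ
open import Data.List.Base using (List; []; _∷_; _++_; concat; length; lookup; tabulate)
open import Data.List.Membership.Propositional using (_∈_)
open import Data.List.Membership.Propositional.Properties using (∈-concat⁺′; ∈-tabulate⁺)
open import Data.List.Relation.Binary.Disjoint.Propositional using (Disjoint)
import Data.List.Relation.Unary.All.Properties as All
import Data.List.Relation.Unary.AllPairs.Properties as AllPairs
open import Data.List.Relation.Unary.Unique.Propositional using (Unique)
import Data.List.Relation.Unary.Unique.Propositional.Properties as Unique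
open import Data.Nat.Base as ℕ using (ℕ; zero; suc)
import Data.Nat.Coprimality as Coprimality
import Data.Nat.Properties as ℕ
open import Data.Product.Base using (∃; _×_; _,_)
open import Data.Rational.Base
open import Data.Rational.Properties
open import Data.Rational.Solver using (module +-*-Solver)
open import Data.Sum.Base using (_⊎_; inj₁; inj₂)
open import Data.Vec.Functional using (Vector; map)
open import Level using (0ℓ)
open import Relation.Binary.Core using (Rel)
open import Relation.Binary.Definitions using (Decidable; Symmetric; Irreflexive)
open import Relation.Binary.PropositionalEquality
open import Relation.Nullary.Decidable using (Dec; yes; no; does)
open import Relation.Nullary.Negation using (¬_; contradiction)

open +-*-Solver using (solve; _:=_; _:+_; _:*_; _:-_; :-_; con)

Close : ℚ → ℚ → ℚ → Set
Close ε p q = ∣ p - q ∣ ≤ ε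

infix 4 _⟵_
_⟵_ : ∀ {r s ε} → r ≡ s → ∣ s ∣ ≤ ε → ∣ r ∣ ≤ ε
refl ⟵ h = h

half-sum : ∀ ε → ½ * ε + ½ * ε ≡ ε
half-sum = solve 1 (λ ε → con ½ :* ε :+ con ½ :* ε := ε) refl

half-pos : ∀ {ε} → 0ℚ < ε → 0ℚ < ½ * ε
half-pos 0<ε = *-monoʳ-<-pos ½ 0<ε

*-pos : ∀ {p q} → 0ℚ < p → 0ℚ < q → 0ℚ < p * q
*-pos {p} {q} 0<p 0<q =
  positive⁻¹ (p * q) {{pos*pos⇒pos p {{positive 0<p}} q {{positive 0<q}}}}

*-mono : ∀ {p p′ q q′} → 0ℚ ≤ p → 0ℚ ≤ q′ → p ≤ p′ → q ≤ q′ → p * q ≤ p′ * q′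
*-mono {p} {p′} {q} {q′} 0≤p 0≤q′ p≤p′ q≤q′ = ≤-trans
  (*-monoˡ-≤-nonNeg p {{nonNegative 0≤p}} q≤q′)
  (*-monoʳ-≤-nonNeg q′ {{nonNegative 0≤q′}} p≤p′)

close-refl : ∀ {ε} p → 0ℚ ≤ ε → Close ε p p
close-refl p 0≤ε = +-inverseʳ p ⟵ 0≤ε

close-sym : ∀ {ε p q} → Close ε p q → Close ε q p
close-sym {ε} {p} {q} h = subst (_≤ ε)
  (trans (sym (∣-p∣≡∣p∣ (p - q)))
         (cong ∣_∣ (solve 2 (λ p q → :- (p :- q) := q :- p) refl p q))) h

triangle : ∀ {ε δ} r s → ∣ r ∣ ≤ ε → ∣ s ∣ ≤ δ → ∣ r + s ∣ ≤ ε + δ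
triangle r s h k = ≤-trans (∣p+q∣≤∣p∣+∣q∣ r s) (+-mono-≤ h k)

∣∣-* : ∀ {ε δ} r s → ∣ r ∣ ≤ ε → ∣ s ∣ ≤ δ → ∣ r * s ∣ ≤ ε * δ
∣∣-* r s h k = ≤-trans (≤-reflexive (∣p*q∣≡∣p∣*∣q∣ r s))
  (*-mono (0≤∣p∣ r) (≤-trans (0≤∣p∣ s) k) h k)

close-trans : ∀ {ε δ p q r} → Close ε p q → Close δ q r → Close (ε + δ) p r
close-trans {p = p} {q} {r} h k =
  solve 3 (λ p q r → p :- r := (p :- q) :+ (q :- r)) refl p q r
  ⟵ triangle (p - q) (q - r) h k

close-+ : ∀ {ε δ p p′ q q′} → Close ε p p′ → Close δ q q′ → Close (ε + δ) (p + q) (p′ + q′)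
close-+ {p = p} {p′} {q} {q′} h k =
  solve 4 (λ p p′ q q′ → (p :+ q) :- (p′ :+ q′) := (p :- p′) :+ (q :- q′)) refl p p′ q q′
  ⟵ triangle (p - p′) (q - q′) h k

close-neg : ∀ {ε p q} → Close ε p q → Close ε (- p) (- q)
close-neg {ε} {p} {q} h =
  solve 2 (λ p q → (:- p) :- (:- q) := q :- p) refl p q ⟵ close-sym {ε} {p} {q} h

close-* : ∀ {B δ p p′ q q′} → ∣ p ∣ ≤ B → ∣ q′ ∣ ≤ B →
          Close δ p p′ → Close δ q q′ → Close (B * δ + δ * B) (p * q) (p′ * q′)
close-* {p = p} {p′} {q} {q′} p≤B q′≤B h k =
  solve 4 (λ p p′ q q′ → p :* q :- p′ :* q′ := p :* (q :- q′) :+ (p :- p′) :* q′) refl p p′ q q′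
  ⟵ triangle (p * (q - q′)) ((p - p′) * q′) (∣∣-* p (q - q′) p≤B k) (∣∣-* (p - p′) q′ h q′≤B)

Cauchy : (ℕ → ℚ) → Set
Cauchy s = ∀ ε → 0ℚ < ε → ∃ λ N → ∀ m n → N ℕ.≤ m → N ℕ.≤ n → Close ε (s m) (s n)

-- Real numbers are Cauchy sequences of rationals, up to _≈ℝ_.
record ℝ : Set where
  no-eta-equality
  field
    seq    : ℕ → ℚ
    cauchy : Cauchy seq

open ℝ public

infix 4 _≈ℝ_
_≈ℝ_ : Rel ℝ 0ℓ
x ≈ℝ y = ∀ ε → 0ℚ < ε → ∃ λ N → ∀ n → N ℕ.≤ n → Close ε (seq x n) (seq y n)

fromℚ : ℚ → ℝ
fromℚ q .seq _ = q
fromℚ q .cauchy ε 0<ε = 0 , λ _ _ _ _ → close-refl q (<⇒≤ 0<ε)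

infixl 6 _+ℝ_
_+ℝ_ : ℝ → ℝ → ℝ
(x +ℝ y) .seq n = seq x n + seq y n
(x +ℝ y) .cauchy ε 0<ε =
  let (M , hx) = cauchy x (½ * ε) (half-pos 0<ε)
      (N , hy) = cauchy y (½ * ε) (half-pos 0<ε)
  in M ℕ.⊔ N , λ m n m≥ n≥ →
     subst (λ η → Close η (seq x m + seq y m) (seq x n + seq y n)) (half-sum ε)
       (close-+ {p = seq x m} {seq x n} {seq y m} {seq y n}
         (hx m n (ℕ.m⊔n≤o⇒m≤o M N m≥) (ℕ.m⊔n≤o⇒m≤o M N n≥))
         (hy m n (ℕ.m⊔n≤o⇒n≤o M N m≥) (ℕ.m⊔n≤o⇒n≤o M N n≥)))

-ℝ_ : ℝ → ℝ
(-ℝ x) .seq n = - seq x n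
(-ℝ x) .cauchy ε 0<ε =
  let (N , h) = cauchy x ε 0<ε
  in N , λ m n m≥ n≥ → close-neg {p = seq x m} {seq x n} (h m n m≥ n≥)

-- A Cauchy sequence is eventually bounded, by a bound that is at least 1.
bounded : ∀ x → ∃ λ B → 1ℚ ≤ B × ∃ λ N → ∀ n → N ℕ.≤ n → ∣ seq x n ∣ ≤ B
bounded x =
  let (N , h) = cauchy x 1ℚ (positive⁻¹ 1ℚ)
      c = seq x N
  in 1ℚ + ∣ c ∣ , subst (_≤ 1ℚ + ∣ c ∣) (+-identityʳ 1ℚ) (+-monoʳ-≤ 1ℚ (0≤∣p∣ c)) , N , λ n n≥ →
     solve 2 (λ p c → p := (p :- c) :+ c) refl (seq x n) c
     ⟵ triangle (seq x n - c) c (h n N n≥ ℕ.≤-refl) ≤-refl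

1≤⇒0< : ∀ {B} → 1ℚ ≤ B → 0ℚ < B
1≤⇒0< = <-≤-trans (positive⁻¹ 1ℚ)

recip-pos : ∀ {c} (0<c : 0ℚ < c) → 0ℚ < (1/ c) {{pos⇒nonZero c {{positive 0<c}}}}
recip-pos {c} 0<c = positive⁻¹ _ {{1/pos⇒pos c {{positive 0<c}}}}

-- Tolerance in the factors that keeps a product with factors bounded by B within ε.
productTol : ∀ B → 0ℚ < B → ∀ ε → 0ℚ < ε →
             ∃ λ δ → 0ℚ < δ × B * δ + δ * B ≡ ε
productTol B 0<B ε 0<ε = (½ * ε) * 1/B , *-pos (half-pos 0<ε) (recip-pos 0<B) , eq
  where
  open ≡-Reasoning
  instance B≢0 = pos⇒nonZero B {{positive 0<B}}
  1/B = 1/ B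
  eq : B * ((½ * ε) * 1/B) + ((½ * ε) * 1/B) * B ≡ ε
  eq = begin
    B * ((½ * ε) * 1/B) + ((½ * ε) * 1/B) * B
      ≡⟨ solve 3 (λ B ε b → B :* ((con ½ :* ε) :* b) :+ ((con ½ :* ε) :* b) :* B := ε :* (B :* b)) refl B ε 1/B ⟩
    ε * (B * 1/B) ≡⟨ cong (ε *_) (*-inverseʳ B) ⟩
    ε * 1ℚ        ≡⟨ *-identityʳ ε ⟩
    ε             ∎

infixl 7 _*ℝ_
_*ℝ_ : ℝ → ℝ → ℝ
(x *ℝ y) .seq n = seq x n * seq y n
(x *ℝ y) .cauchy ε 0<ε =
  let (A , 1≤A , M , hA) = bounded x
      (B , 1≤B , N , hB) = bounded y
      (δ , 0<δ , eq) = productTol (A ⊔ B) (<-≤-trans (1≤⇒0< 1≤A) (p≤p⊔q A B)) ε 0<ε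
      (P , hx) = cauchy x δ 0<δ
      (Q , hy) = cauchy y δ 0<δ
      L = (M ℕ.⊔ N) ℕ.⊔ (P ℕ.⊔ Q)
      M≤L = ℕ.≤-trans (ℕ.m≤m⊔n M N) (ℕ.m≤m⊔n _ _)
      N≤L = ℕ.≤-trans (ℕ.m≤n⊔m M N) (ℕ.m≤m⊔n _ _)
      P≤L = ℕ.≤-trans (ℕ.m≤m⊔n P Q) (ℕ.m≤n⊔m (M ℕ.⊔ N) _)
      Q≤L = ℕ.≤-trans (ℕ.m≤n⊔m P Q) (ℕ.m≤n⊔m (M ℕ.⊔ N) _)
  in L , λ m n m≥ n≥ →
     subst (λ η → Close η (seq x m * seq y m) (seq x n * seq y n)) eq
       (close-* {p = seq x m} {seq x n} {seq y m} {seq y n}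
         (≤-trans (hA m (ℕ.≤-trans M≤L m≥)) (p≤p⊔q A B))
         (≤-trans (hB n (ℕ.≤-trans N≤L n≥)) (p≤q⊔p A B))
         (hx m n (ℕ.≤-trans P≤L m≥) (ℕ.≤-trans P≤L n≥))
         (hy m n (ℕ.≤-trans Q≤L m≥) (ℕ.≤-trans Q≤L n≥)))

Positiveℝ : ℝ → Set
Positiveℝ x = ∃ λ c → 0ℚ < c × ∃ λ N → ∀ n → N ℕ.≤ n → c ≤ seq x n

-- Reciprocal of a rational, with value 0 at 0.
inv : ℚ → ℚ
inv q with q ≟ 0ℚ
... | yes _   = 0ℚ
... | no  q≢0 = (1/ q) {{≢-nonZero q≢0}}

inv-inverse : ∀ {q} → 0ℚ < q → inv q * q ≡ 1ℚ
inv-inverse {q} 0<q with q ≟ 0ℚ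
... | yes q≡0 = contradiction (sym q≡0) (<⇒≢ 0<q)
... | no  q≢0 = *-inverseˡ q {{≢-nonZero q≢0}}

inv-bound : ∀ {c q} → 0ℚ < c → c ≤ q → ∣ inv q ∣ ≤ inv c
inv-bound {c} {q} 0<c c≤q = *-cancelʳ-≤-pos c {{positive 0<c}} (begin
  ∣ inv q ∣ * c ≤⟨ *-monoˡ-≤-nonNeg ∣ inv q ∣ {{∣-∣-nonNeg (inv q)}} c≤q ⟩
  ∣ inv q ∣ * q     ≡⟨ cong (∣ inv q ∣ *_) (sym (0≤p⇒∣p∣≡p (<⇒≤ 0<q))) ⟩
  ∣ inv q ∣ * ∣ q ∣ ≡⟨ sym (∣p*q∣≡∣p∣*∣q∣ (inv q) q) ⟩
  ∣ inv q * q ∣     ≡⟨ cong ∣_∣ (inv-inverse 0<q) ⟩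
  1ℚ                ≡⟨ sym (inv-inverse 0<c) ⟩
  inv c * c         ∎)
  where
  open ≤-Reasoning
  0<q = <-≤-trans 0<c c≤q

inv-close : ∀ {c p q δ} → 0ℚ < c → c ≤ p → c ≤ q → Close δ p q →
            Close (inv c * inv c * δ) (inv p) (inv q)
inv-close {c} {p} {q} {δ} 0<c c≤p c≤q h = eq
  ⟵ ∣∣-* (inv p * inv q) (q - p)
       (∣∣-* (inv p) (inv q) (inv-bound 0<c c≤p) (inv-bound 0<c c≤q))
       (close-sym {δ} {p} {q} h)
  where
  open ≡-Reasoning
  eq : inv p - inv q ≡ inv p * inv q * (q - p)
  eq = begin
    inv p - inv q
      ≡⟨ sym (cong₂ _-_ (*-identityʳ (inv p)) (*-identityʳ (inv q))) ⟩
    inv p * 1ℚ - inv q * 1ℚ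
      ≡⟨ sym (cong₂ (λ r s → inv p * r - inv q * s)
           (inv-inverse (<-≤-trans 0<c c≤q)) (inv-inverse (<-≤-trans 0<c c≤p))) ⟩
    inv p * (inv q * q) - inv q * (inv p * p)
      ≡⟨ solve 4 (λ p q u v → u :* (v :* q) :- v :* (u :* p) := u :* v :* (q :- p)) refl p q (inv p) (inv q) ⟩
    inv p * inv q * (q - p) ∎

inverse : (x : ℝ) → Positiveℝ x → ℝ
inverse x _ .seq n = inv (seq x n)
inverse x (c , 0<c , M , lower) .cauchy ε 0<ε =
  let (N , h) = cauchy x (c * c * ε) (*-pos (*-pos 0<c 0<c) 0<ε)
      eq : inv c * inv c * (c * c * ε) ≡ ε
      eq = trans (solve 3 (λ c d ε → d :* d :* (c :* c :* ε) := (d :* c) :* (d :* c) :* ε) refl c (inv c) ε)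
          (trans (cong (λ r → r * r * ε) (inv-inverse 0<c)) (*-identityˡ ε))
  in M ℕ.⊔ N , λ m n m≥ n≥ →
     subst (λ η → Close η (inv (seq x m)) (inv (seq x n))) eq
       (inv-close 0<c (lower m (ℕ.m⊔n≤o⇒m≤o M N m≥)) (lower n (ℕ.m⊔n≤o⇒m≤o M N n≥))
         (h m n (ℕ.m⊔n≤o⇒n≤o M N m≥) (ℕ.m⊔n≤o⇒n≤o M N n≥)))

ι : ℕ → ℚ
ι k = mkℚ (+ k) 0 (Coprimality.sym (Coprimality.1-coprimeTo k))

mesh : ℕ → ℚ
mesh n = 1/ ι (suc n)

sq : ℚ → ℚ
sq p = p * p

-- The largest k ≤ b with (k · d)² ≤ q, or 0 if there is none.
search : ℚ → ℚ → ℕ → ℕ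
search d q zero    = zero
search d q (suc b) = if does (sq (ι (suc b) * d) ≤? q) then suc b else search d q b

-- The largest multiple of mesh n whose square is at most q, or 0 if q < 0;
-- the search range is large enough by √-above below.  Opaque only to keep
-- type checking fast: √-nonNeg, √-below and √-above determine it up to mesh n.
opaque
  √≈ : ℕ → ℚ → ℚ
  √≈ n q = ι (search (mesh n) q (suc ℤ.∣ ↥ q ∣ ℕ.* suc n)) * mesh n

sq-mono : ∀ {p q} → 0ℚ ≤ p → p ≤ q → sq p ≤ sq q
sq-mono 0≤p p≤q = *-mono 0≤p (≤-trans 0≤p p≤q) p≤q p≤q

sq-mono-< : ∀ {p q} → 0ℚ ≤ p → p < q → sq p < sq q
sq-mono-< {p} {q} 0≤p p<q = ≤-<-trans
  (*-monoˡ-≤-nonNeg p {{nonNegative 0≤p}} (<⇒≤ p<q))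
  (*-monoˡ-<-pos q {{positive (≤-<-trans 0≤p p<q)}} p<q)

+-nonNeg : ∀ {p q} → 0ℚ ≤ p → 0ℚ ≤ q → 0ℚ ≤ p + q
+-nonNeg {p} {q} 0≤p 0≤q = subst (_≤ p + q) (+-identityˡ 0ℚ) (+-mono-≤ 0≤p 0≤q)

p≤p+ : ∀ p {q} → 0ℚ ≤ q → p ≤ p + q
p≤p+ p 0≤q = subst (_≤ p + _) (+-identityʳ p) (+-monoʳ-≤ p 0≤q)

*-nonNeg : ∀ {p q} → 0ℚ ≤ p → 0ℚ ≤ q → 0ℚ ≤ p * q
*-nonNeg {p} {q} 0≤p 0≤q = nonNegative⁻¹ _
  {{nonNeg*nonNeg⇒nonNeg p {{nonNegative 0≤p}} q {{nonNegative 0≤q}}}}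

0≤ι : ∀ k → 0ℚ ≤ ι k
0≤ι k = nonNegative⁻¹ (ι k)

0<mesh : ∀ n → 0ℚ < mesh n
0<mesh n = positive⁻¹ (mesh n)

ι-+ : ∀ j k → ι (j ℕ.+ k) ≡ ι j + ι k
ι-+ j k = trans (sym (↥p/↧p≡p (ι (j ℕ.+ k)))) (cong (_/ 1)
  (cong₂ ℤ._+_ (sym (ℤ.*-identityʳ (+ j))) (sym (ℤ.*-identityʳ (+ k)))))

ι-* : ∀ j k → ι (j ℕ.* k) ≡ ι j * ι k
ι-* j k = trans (sym (↥p/↧p≡p (ι (j ℕ.* k)))) (cong (_/ 1) (ℤ.pos-* j k))

ι-suc : ∀ k r → ι (suc k) * r ≡ ι k * r + r
ι-suc k r = trans (cong (_* r) (ι-+ 1 k))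
  (solve 2 (λ k r → (con 1ℚ :+ k) :* r := k :* r :+ r) refl (ι k) r)

q≤∣↥q∣ : ∀ q → q ≤ ι ℤ.∣ ↥ q ∣
q≤∣↥q∣ q@(mkℚ (+ p) d _) = *≤* (ℤ.*-monoˡ-≤-nonNeg (+ p) (ℤ.+≤+ (ℕ.s≤s ℕ.z≤n)))
q≤∣↥q∣ q@(mkℚ -[1+ p ] d _) = ≤-trans (nonPositive⁻¹ q) (0≤ι (suc p))

if-elim : ∀ {p} {P : Set p} {k l : ℕ} (Q : ℕ → Set) (P? : Dec P) →
          (P → Q k) → (¬ P → Q l) → Q (if does P? then k else l)
if-elim Q (yes p) f g = f p
if-elim Q (no ¬p) f g = g ¬p

below : ∀ d q b → ι (search d q b) * d ≡ 0ℚ ⊎ sq (ι (search d q b) * d) ≤ q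
below d q zero    = inj₁ (*-zeroˡ d)
below d q (suc b) = if-elim (λ k → ι k * d ≡ 0ℚ ⊎ sq (ι k * d) ≤ q)
  (sq (ι (suc b) * d) ≤? q) inj₂ (λ _ → below d q b)

above : ∀ d q b → q ≤ sq (ι (suc b) * d) → q ≤ sq (ι (search d q b) * d + d)
above d q zero    h = subst (λ r → q ≤ sq r) (ι-suc 0 d) h
above d q (suc b) h = if-elim (λ k → q ≤ sq (ι k * d + d))
  (sq (ι (suc b) * d) ≤? q)
  (λ _ → subst (λ r → q ≤ sq r) (ι-suc (suc b) d) h)
  (λ ≰q → above d q b (<⇒≤ (≰⇒> ≰q)))

ι-mesh : ∀ k n → ι (k ℕ.* suc n) * mesh n ≡ ι k
ι-mesh k n = begin
  ι (k ℕ.* suc n) * mesh n      ≡⟨ cong (_* mesh n) (ι-* k (suc n)) ⟩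
  ι k * ι (suc n) * mesh n      ≡⟨ *-assoc (ι k) (ι (suc n)) (mesh n) ⟩
  ι k * (ι (suc n) * mesh n)    ≡⟨ cong (ι k *_) (*-inverseʳ (ι (suc n))) ⟩
  ι k * 1ℚ                      ≡⟨ *-identityʳ (ι k) ⟩
  ι k                           ∎
  where open ≡-Reasoning

range : ∀ n q → q ≤ sq (ι (suc (suc ℤ.∣ ↥ q ∣ ℕ.* suc n)) * mesh n)
range n q = ≤-trans q≤k² (sq-mono (0≤ι k) k≤)
  where
  p = ℤ.∣ ↥ q ∣
  k = suc p
  b = k ℕ.* suc n

  k≤ : ι k ≤ ι (suc b) * mesh n
  k≤ = subst₂ _≤_ (ι-mesh k n) (sym (ι-suc b (mesh n))) (p≤p+ (ι b * mesh n) (<⇒≤ (0<mesh n)))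

  q≤k² : q ≤ sq (ι k)
  q≤k² = ≤-trans (q≤∣↥q∣ q) (subst (ι p ≤_)
    (sym (trans (cong sq (ι-+ 1 p))
      (solve 1 (λ p → (con 1ℚ :+ p) :* (con 1ℚ :+ p) := p :+ (con 1ℚ :+ p :+ p :* p)) refl (ι p))))
    (p≤p+ (ι p) (+-nonNeg (+-nonNeg (nonNegative⁻¹ 1ℚ) (0≤ι p)) (*-nonNeg (0≤ι p) (0≤ι p)))))

opaque
  unfolding √≈

  √-nonNeg : ∀ n q → 0ℚ ≤ √≈ n q
  √-nonNeg n q = *-nonNeg (0≤ι (search (mesh n) q (suc ℤ.∣ ↥ q ∣ ℕ.* suc n))) (<⇒≤ (0<mesh n))

  √-below : ∀ n q → √≈ n q ≡ 0ℚ ⊎ sq (√≈ n q) ≤ q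
  √-below n q = below (mesh n) q (suc ℤ.∣ ↥ q ∣ ℕ.* suc n)

  √-above : ∀ n q → q ≤ sq (√≈ n q + mesh n)
  √-above n q = above (mesh n) q (suc ℤ.∣ ↥ q ∣ ℕ.* suc n) (range n q)

mesh-anti : ∀ {m n} → m ℕ.≤ n → mesh n ≤ mesh m
mesh-anti {m} {n} m≤n = *≤* (ℤ.*-monoˡ-≤-nonNeg (+ 1) {+ suc m} {+ suc n} (ℤ.+≤+ (ℕ.s≤s m≤n)))

mesh-small : ∀ ε → 0ℚ < ε → ∃ λ N → ∀ n → N ℕ.≤ n → mesh n ≤ ε
mesh-small ε 0<ε = ℚ.denominator-1 ε , λ n N≤n → ≤-trans (mesh-anti N≤n) (bound ε {{positive 0<ε}})
  where
  bound : ∀ ε → .{{Positive ε}} → mesh (ℚ.denominator-1 ε) ≤ ε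
  bound (mkℚ (+ suc p) d _) = *≤* (ℤ.*-monoʳ-≤-nonNeg (+ suc d) {+ 1} {+ suc p} (ℤ.+≤+ (ℕ.s≤s ℕ.z≤n)))

square-sum : ∀ {p q} → 0ℚ ≤ p → 0ℚ ≤ q → sq p + sq q ≤ sq (p + q)
square-sum {p} {q} 0≤p 0≤q = subst (sq p + sq q ≤_)
  (solve 2 (λ p q → p :* p :+ q :* q :+ (p :* q :+ p :* q) := (p :+ q) :* (p :+ q)) refl p q)
  (p≤p+ (sq p + sq q) (+-nonNeg (*-nonNeg 0≤p 0≤q) (*-nonNeg 0≤p 0≤q)))

sq-cancel : ∀ {p q} → 0ℚ ≤ q → sq p ≤ sq q → p ≤ q
sq-cancel {p} {q} 0≤q h = ≮⇒≥ λ q<p → <-irrefl {x = sq q} refl (<-≤-trans (sq-mono-< 0≤q q<p) h)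

one-sided : ∀ m n {p q η} → 0ℚ ≤ η → p ≤ q + η * η → √≈ m p ≤ √≈ n q + (mesh n + η)
one-sided m n {p} {q} {η} 0≤η p≤q+η² = case (√-below m p)
  where
  open ≤-Reasoning
  a = √≈ m p
  b = √≈ n q
  d = mesh n
  0≤d = <⇒≤ (0<mesh n)
  0≤b = √-nonNeg n q
  0≤b+d = +-nonNeg 0≤b 0≤d
  0≤b+d+η = +-nonNeg 0≤b (+-nonNeg 0≤d 0≤η)

  p≤ : p ≤ sq (b + (d + η))
  p≤ = begin
    p                      ≤⟨ p≤q+η² ⟩
    q + η * η              ≤⟨ +-monoˡ-≤ (η * η) (√-above n q) ⟩
    sq (b + d) + η * η     ≤⟨ square-sum 0≤b+d 0≤η ⟩
    sq (b + d + η)         ≡⟨ cong sq (+-assoc b d η) ⟩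
    sq (b + (d + η))       ∎

  case : a ≡ 0ℚ ⊎ sq a ≤ p → a ≤ b + (d + η)
  case (inj₁ a≡0)  = subst (_≤ b + (d + η)) (sym a≡0) 0≤b+d+η
  case (inj₂ a²≤p) = sq-cancel 0≤b+d+η (≤-trans a²≤p p≤)

p≤∣p∣ : ∀ p → p ≤ ∣ p ∣
p≤∣p∣ p with ≤-total 0ℚ p
... | inj₁ 0≤p = ≤-reflexive (sym (0≤p⇒∣p∣≡p 0≤p))
... | inj₂ p≤0 = ≤-trans p≤0 (0≤∣p∣ p)

close⇒≤ : ∀ {ε p q} → Close ε p q → p ≤ q + ε
close⇒≤ {ε} {p} {q} h = subst (_≤ q + ε)
  (solve 2 (λ p q → q :+ (p :- q) := p) refl p q)
  (+-monoʳ-≤ q (≤-trans (p≤∣p∣ (p - q)) h))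

≤⇒diff≤ : ∀ {ε p q} → p ≤ q + ε → p - q ≤ ε
≤⇒diff≤ {ε} {p} {q} h = subst (p - q ≤_)
  (solve 2 (λ q ε → (q :+ ε) :- q := ε) refl q ε) (+-monoˡ-≤ (- q) h)

≤⇒close : ∀ {ε p q} → p ≤ q + ε → q ≤ p + ε → Close ε p q
≤⇒close {ε} {p} {q} h k with ∣p∣≡p∨∣p∣≡-p (p - q)
... | inj₁ eq = subst (_≤ ε) (sym eq) (≤⇒diff≤ h)
... | inj₂ eq = subst (_≤ ε) (sym (trans eq (solve 2 (λ p q → :- (p :- q) := q :- p) refl p q))) (≤⇒diff≤ k)

-- √ x for x ≥ 0; in general the square root of max x 0.
√_ : ℝ → ℝ
(√ x) .seq n = √≈ n (seq x n)
(√ x) .cauchy ε 0<ε =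
  let η       = ½ * ε
      0<η     = half-pos 0<ε
      (M , hx) = cauchy x (η * η) (*-pos 0<η 0<η)
      (N , hm) = mesh-small η 0<η
      side : ∀ m n → M ℕ.⊔ N ℕ.≤ m → M ℕ.⊔ N ℕ.≤ n → √≈ m (seq x m) ≤ √≈ n (seq x n) + ε
      side m n m≥ n≥ = ≤-trans
        (one-sided m n (<⇒≤ 0<η) (close⇒≤ (hx m n (ℕ.m⊔n≤o⇒m≤o M N m≥) (ℕ.m⊔n≤o⇒m≤o M N n≥))))
        (+-monoʳ-≤ (√≈ n (seq x n)) (≤-trans
          (+-monoˡ-≤ η (hm n (ℕ.m⊔n≤o⇒n≤o M N n≥))) (≤-reflexive (half-sum ε))))
  in M ℕ.⊔ N , λ m n m≥ n≥ → ≤⇒close (side m n m≥ n≥) (side n m n≥ m≥)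

√-positive : ∀ x → (∀ n → 1ℚ ≤ seq x n) → Positiveℝ (√ x)
√-positive x 1≤x = ½ , positive⁻¹ ½ , 1 , λ n 1≤n → bound n 1≤n
  where
  bound : ∀ n → 1 ℕ.≤ n → ½ ≤ √≈ n (seq x n)
  bound n 1≤n = ≮⇒≥ λ y<½ → <-irrefl {x = 1ℚ} refl (≤-<-trans
    (≤-trans (1≤x n) (√-above n (seq x n)))
    (sq-mono-< {q = 1ℚ} (+-nonNeg (√-nonNeg n (seq x n)) (<⇒≤ (0<mesh n)))
      (+-mono-<-≤ y<½ (mesh-anti 1≤n))))

record ℂ : Set where
  constructor _+i_
  field
    re im : ℝ

open ℂ public

infix 4 _≈_
_≈_ : Rel ℂ 0ℓ
z ≈ w = re z ≈ℝ re w × im z ≈ℝ im w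

ofℝ : ℝ → ℂ
ofℝ x = x +i fromℚ 0ℚ

ℂ-rawRing : RawRing 0ℓ 0ℓ
ℂ-rawRing = record
  { Carrier = ℂ
  ; _≈_ = _≈_
  ; _+_ = λ z w → (re z +ℝ re w) +i (im z +ℝ im w)
  ; _*_ = λ z w → (re z *ℝ re w +ℝ (-ℝ (im z *ℝ im w))) +i (re z *ℝ im w +ℝ im z *ℝ re w)
  ; -_ = λ z → (-ℝ re z) +i (-ℝ im z)
  ; 0# = ofℝ (fromℚ 0ℚ)
  ; 1# = ofℝ (fromℚ 1ℚ)
  }

open RawRing ℂ-rawRing public
  using () renaming (_+_ to _+ᶜ_; _*_ to _*ᶜ_; 0# to 0ᶜ; 1# to 1ᶜ)

conj : ℂ → ℂ
conj z = re z +i (-ℝ im z)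

∣_∣² : ℂ → ℝ
∣ z ∣² = re z *ℝ re z +ℝ im z *ℝ im z

ℝ-+-rawMonoid : RawMonoid 0ℓ 0ℓ
ℝ-+-rawMonoid = record { Carrier = ℝ ; _≈_ = _≈ℝ_ ; _∙_ = _+ℝ_ ; ε = fromℚ 0ℚ }

open RawMonoidSum (RawRing.+-rawMonoid ℂ-rawRing) public using () renaming (sum to ∑)
open RawMonoidSum ℝ-+-rawMonoid public using () renaming (sum to ∑ℝ)
open RawMonoidSum ℕ.+-0-rawMonoid public using () renaming (sum to ∑ℕ)

Matrix : ℕ → ℕ → Set
Matrix m n = Fin m → Fin n → ℂ

infix 4 _≋_
_≋_ : ∀ {m n} → Rel (Matrix m n) 0ℓ
A ≋ B = ∀ i j → A i j ≈ B i j

infixr 7 _·_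
_·_ : ∀ {m n} → ℂ → Matrix m n → Matrix m n
(c · A) i j = c *ᶜ A i j

∑ᴹ : ∀ {k m n} → (Fin k → Matrix m n) → Matrix m n
∑ᴹ A i j = ∑ (λ k → A k i j)

infixl 7 _*ᴹ_
_*ᴹ_ : ∀ {l m n} → Matrix l m → Matrix m n → Matrix l n
(A *ᴹ B) i k = ∑ (λ j → A i j *ᶜ B j k)

1ᴹ : ∀ {n} → Matrix n n
1ᴹ i j = if does (i Fin.≟ j) then 1ᶜ else 0ᶜ

infixr 8 _^ᴹ_
_^ᴹ_ : ∀ {n} → Matrix n n → ℕ → Matrix n n
A ^ᴹ zero  = 1ᴹ
A ^ᴹ suc k = A *ᴹ A ^ᴹ k

infixr 7 _*ᵛ_
_*ᵛ_ : ∀ {m n} → Matrix m n → Vector ℂ n → Vector ℂ m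
(A *ᵛ v) i = ∑ (λ j → A i j *ᶜ v j)

⟨_,_⟩ : ∀ {n} → Vector ℂ n → Vector ℂ n → ℂ
⟨ u , v ⟩ = ∑ (λ i → conj (u i) *ᶜ v i)

‖_‖₂ : ∀ {n} → Vector ℂ n → ℝ
‖ v ‖₂ = √ ∑ℝ (λ i → ∣ v i ∣²)

𝟙 : ∀ N → Vector ℂ N
𝟙 N _ = 1ᶜ

-- Each term ∣ 1ᶜ ∣² is the constant sequence 1.
∑-ones : ∀ N n → seq (∑ℝ {N} (λ _ → ∣ 1ᶜ ∣²)) n ≡ ι N
∑-ones zero    n = refl
∑-ones (suc N) n = trans (cong (λ q → 1ℚ + q) (∑-ones N n)) (sym (ι-+ 1 N))

1≤ι : ∀ N → 1ℚ ≤ ι (suc N)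
1≤ι N = subst (1ℚ ≤_) (sym (ι-+ 1 N)) (p≤p+ 1ℚ {ι N} (0≤ι N))

‖𝟙‖₂-positive : ∀ N → .{{ℕ.NonZero N}} → Positiveℝ ‖ 𝟙 N ‖₂
‖𝟙‖₂-positive (suc N) = √-positive (∑ℝ {suc N} (λ _ → ∣ 1ᶜ ∣²)) λ n →
  subst (1ℚ ≤_) (sym (∑-ones (suc N) n)) (1≤ι N)

𝕖 : ∀ N → .{{ℕ.NonZero N}} → Vector ℂ N
𝕖 N = map (ofℝ (inverse ‖ 𝟙 N ‖₂ (‖𝟙‖₂-positive N)) *ᶜ_) (𝟙 N)

-- φₑ B = ⟨ e , B e ⟩ with e = 𝟙 / ‖ 𝟙 ‖₂; conj is applied to the first argument of ⟨_,_⟩.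
φₑ : ∀ {N} → .{{ℕ.NonZero N}} → Matrix N N → ℂ
φₑ {N} B = ⟨ 𝕖 N , B *ᵛ 𝕖 N ⟩

-- Finite simple graphs with vertices taken from X.  The duplicate-free list
-- fixes an enumeration of the vertex set.  Adjacency is a relation on all of
-- X, so that graphs with different vertex sets can be united.
record Graph {a} (X : Set a) : Set (Level.suc 0ℓ Level.⊔ a) where
  field
    vertices : List X
    distinct : Unique vertices
    nonempty : ℕ.NonZero (length vertices)
    _~_      : Rel X 0ℓ
    _~?_     : Decidable _~_
    ~⇒∈      : ∀ {x y} → x ~ y → x ∈ vertices
    ~-sym    : Symmetric _~_
    ~-irrefl : Irreflexive _≡_ _~_

  order : ℕ
  order = length vertices

  adjacency : Matrix order order
  adjacency i j = if does (lookup vertices i ~? lookup vertices j) then 1ᶜ else 0ᶜ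

open Graph public using (vertices; order; adjacency)

moment : ∀ {a} {X : Set a} → ∀ n → Graph X → Matrix (suc n) (suc n)
moment n G i j = φₑ {{Graph.nonempty G}} (adjacency G ^ᴹ (toℕ i ℕ.+ toℕ j))

module _ {a} {X : Set a} {K : ℕ} where

  MutuallyDisjoint : (Fin K → Graph X) → Set a
  MutuallyDisjoint G = ∀ i j → i ≢ j → Disjoint (vertices (G i)) (vertices (G j))

  totalOrder : (Fin K → Graph X) → ℕ
  totalOrder G = ∑ℕ (λ j → order (G j))

totalOrder-nonZero : ∀ {a} {X : Set a} {K} {{_ : ℕ.NonZero K}} (G : Fin K → Graph X) →
                     ℕ.NonZero (totalOrder G)
totalOrder-nonZero {K = suc _} G =
  ℕ.>-nonZero (ℕ.<-≤-trans (ℕ.>-nonZero⁻¹ _ {{Graph.nonempty (G zero)}}) (ℕ.m≤m+n _ _))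

-- αⱼ / α
weight : ∀ {a} {X : Set a} {K} {{_ : ℕ.NonZero K}} → (Fin K → Graph X) → Fin K → ℂ
weight G j = ofℝ (fromℚ ((+ order (G j) / totalOrder G) {{totalOrder-nonZero G}}))

-- The direct sum (V₁ ∪ ⋯ ∪ V_K , E₁ ∪ ⋯ ∪ E_K).
⨆ : ∀ {a} {X : Set a} {K} {{_ : ℕ.NonZero K}} →
    (G : Fin K → Graph X) → MutuallyDisjoint G → Graph X
⨆ {K = suc K} G disjoint = record
  { vertices = concat (tabulate V)
  ; distinct = Unique.concat⁺
      (All.tabulate⁺ {f = V} (λ j → Graph.distinct (G j)))
      (AllPairs.tabulate⁺ {f = V} (λ {i} {j} → disjoint i j))
  ; nonempty = ++-nonempty (vertices (G zero)) (Graph.nonempty (G zero))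
  ; _~_      = λ x y → ∃ λ j → Graph._~_ (G j) x y
  ; _~?_     = λ x y → Fin.any? (λ j → Graph._~?_ (G j) x y)
  ; ~⇒∈      = λ (j , e) → ∈-concat⁺′ (Graph.~⇒∈ (G j) e) (∈-tabulate⁺ {f = V} j)
  ; ~-sym    = λ (j , e) → j , Graph.~-sym (G j) e
  ; ~-irrefl = λ x≡y (j , e) → Graph.~-irrefl (G j) x≡y e
  }
  where
  V = λ j → vertices (G j)

  ++-nonempty : ∀ xs {ys} → ℕ.NonZero (length xs) → ℕ.NonZero (length (xs ++ ys))
  ++-nonempty (_ ∷ _) _ = _

{-# OPTIONS --safe #-}

-- The entries of Aᵏ are natural numbers, represented by constant Cauchy sequences,
-- so the n-th term of φₑ(Aᵏ) is W · sₙ², where W counts the walks of length k and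
-- sₙ is the n-th approximation of 1/‖𝟙‖₂; hence φₑ(Aᵏ) = W / order.  A walk in the
-- disjoint union stays in one summand, so walk numbers add up, and the weights
-- turn the averages over the summands into the average over the union.
module Submission where

open import Defs
open import Algebra.Bundles using (CommutativeRing)
open import Data.Bool.Base using (Bool; true; false; if_then_else_)
open import Data.Fin.Base using (Fin; zero; suc; toℕ)
import Data.Fin.Properties as Fin
import Data.Integer.Base as ℤ
import Data.Integer.Properties as ℤ
open import Data.List.Base using (List; []; _∷_; _++_; concat; length; lookup; tabulate)
open import Data.List.Membership.Propositional using (_∈_)
open import Data.List.Membership.Propositional.Properties using (∈-lookup)
open import Data.List.Properties using (length-++)
open import Data.Nat.Base as ℕ using (ℕ; zero; suc; NonZero)
import Data.Nat.Properties as ℕ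
open import Data.Product.Base using (∃; _,_)
open import Data.Rational.Base hiding (NonZero)
open import Data.Rational.Properties
open import Data.Rational.Solver using (module +-*-Solver)
import Data.Rational.Unnormalised.Base as ℚᵘ
import Data.Rational.Unnormalised.Properties as ℚᵘ
open import Data.Sum.Base using (inj₁; inj₂)
open import Function.Base using (_∘_)
open import Function.Bundles using (mk⇔)
open import Relation.Binary.PropositionalEquality
open import Relation.Nullary.Decidable using (yes; no; does; dec-true; dec-false; does-⇔)
open import Relation.Nullary.Negation using (contradiction)

open import Algebra.Properties.Semiring.Sum (CommutativeRing.semiring +-*-commutativeRing)
  using (sum-cong-≗; ∑-comm; *-distribˡ-sum; *-distribʳ-sum)
  renaming (sum to ∑ℚ)
open +-*-Solver using (solve; _:=_; _:+_; _:*_; _:-_)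

-- Finite sums of rationals

∑-zero : ∀ {N} (f : Fin N → ℚ) → (∀ i → f i ≡ 0ℚ) → ∑ℚ f ≡ 0ℚ
∑-zero {zero}  f f≡0 = refl
∑-zero {suc N} f f≡0 = cong₂ _+_ (f≡0 zero) (∑-zero (f ∘ suc) (f≡0 ∘ suc))

∑-single : ∀ {N} (f : Fin N → ℚ) i → (∀ j → i ≢ j → f j ≡ 0ℚ) → ∑ℚ f ≡ f i
∑-single f zero f≡0 =
  trans (cong (f zero +_) (∑-zero (f ∘ suc) λ j → f≡0 (suc j) λ ())) (+-identityʳ (f zero))
∑-single f (suc i) f≡0 = trans
  (cong₂ _+_ (f≡0 zero λ ()) (∑-single (f ∘ suc) i λ j i≢j → f≡0 (suc j) (i≢j ∘ Fin.suc-injective)))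
  (+-identityˡ (f (suc i)))

-- Indexed through `lookup` so that it coincides definitionally with the sums over the row and
-- column indices of an adjacency matrix.
sumOver : ∀ {a} {X : Set a} → (X → ℚ) → List X → ℚ
sumOver f xs = ∑ℚ (λ i → f (lookup xs i))

sumOver-cong : ∀ {a} {X : Set a} {f g : X → ℚ} xs → (∀ {x} → x ∈ xs → f x ≡ g x) →
               sumOver f xs ≡ sumOver g xs
sumOver-cong xs f≡g = sum-cong-≗ λ i → f≡g (∈-lookup {xs = xs} i)

sumOver-++ : ∀ {a} {X : Set a} (f : X → ℚ) xs ys →
             sumOver f (xs ++ ys) ≡ sumOver f xs + sumOver f ys
sumOver-++ f []       ys = sym (+-identityˡ (sumOver f ys))
sumOver-++ f (x ∷ xs) ys = trans (cong (f x +_) (sumOver-++ f xs ys))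
  (sym (+-assoc (f x) (sumOver f xs) (sumOver f ys)))

sumOver-concat : ∀ {a} {X : Set a} (f : X → ℚ) {K} (V : Fin K → List X) →
                 sumOver f (concat (tabulate V)) ≡ ∑ℚ (λ j → sumOver f (V j))
sumOver-concat f {zero}  V = refl
sumOver-concat f {suc K} V = trans (sumOver-++ f (V zero) (concat (tabulate (V ∘ suc))))
  (cong (λ q → sumOver f (V zero) + q) (sumOver-concat f (V ∘ suc)))

length-concat : ∀ {a} {X : Set a} {K} (V : Fin K → List X) →
                length (concat (tabulate V)) ≡ ∑ℕ (λ j → length (V j))
length-concat {K = zero}  V = refl
length-concat {K = suc K} V = trans (length-++ (V zero))
  (cong (length (V zero) ℕ.+_) (length-concat (V ∘ suc)))

-- Terms of the representing sequences

ev : ℕ → ℂ → ℚ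
ev n z = seq (re z) n

-- An exact equation for the single index `n`, not merely a limit: the matrices involved have
-- imaginary parts that vanish term by term.
RealAt : ℕ → ℂ → Set
RealAt n z = seq (im z) n ≡ 0ℚ

ev-∑ : ∀ n {N} (f : Fin N → ℂ) → ev n (∑ f) ≡ ∑ℚ (λ i → ev n (f i))
ev-∑ n {zero}  f = refl
ev-∑ n {suc N} f = cong (λ q → ev n (f zero) + q) (ev-∑ n (f ∘ suc))

real-∑ : ∀ n {N} (f : Fin N → ℂ) → (∀ i → RealAt n (f i)) → RealAt n (∑ f)
real-∑ n {zero}  f h = refl
real-∑ n {suc N} f h = cong₂ _+_ (h zero) (real-∑ n (f ∘ suc) (h ∘ suc))

-- The real part of a product subtracts the product of the imaginary parts, and one vanishing factor
-- kills that.
ev-* : ∀ n z w → RealAt n z → ev n (z *ᶜ w) ≡ ev n z * ev n w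
ev-* n z w h = begin
  ev n z * ev n w - seq (im z) n * seq (im w) n
    ≡⟨ cong (λ q → ev n z * ev n w - q * seq (im w) n) h ⟩
  ev n z * ev n w - 0ℚ * seq (im w) n
    ≡⟨ cong (λ q → ev n z * ev n w - q) (*-zeroˡ (seq (im w) n)) ⟩
  ev n z * ev n w + 0ℚ
    ≡⟨ +-identityʳ (ev n z * ev n w) ⟩
  ev n z * ev n w ∎
  where open ≡-Reasoning

real-* : ∀ n z w → RealAt n z → RealAt n w → RealAt n (z *ᶜ w)
real-* n z w h k = trans (cong₂ (λ p q → ev n z * q + p * ev n w) h k)
  (cong₂ _+_ (*-zeroʳ (ev n z)) (*-zeroˡ (ev n w)))

indicator : Bool → ℚ
indicator b = if b then 1ℚ else 0ℚ

ev-if : ∀ n b → ev n (if b then 1ᶜ else 0ᶜ) ≡ indicator b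
ev-if n true  = refl
ev-if n false = refl

real-if : ∀ n b → RealAt n (if b then 1ᶜ else 0ᶜ)
real-if n true  = refl
real-if n false = refl

real-^ : ∀ n {N} (A : Matrix N N) → (∀ i j → RealAt n (A i j)) →
         ∀ k i j → RealAt n ((A ^ᴹ k) i j)
real-^ n A h zero    i j = real-if n (does (i Fin.≟ j))
real-^ n A h (suc k) i j = real-∑ n _ λ l →
  real-* n (A i l) ((A ^ᴹ k) l j) (h i l) (real-^ n A h k l j)

-- The `n`-th term of 1/‖𝟙‖₂, because ‖𝟙‖₂² is the constant sequence `ι N`.
scale : ℕ → ℕ → ℚ
scale N n = inv (√≈ n (ι N))

ev-𝕖 : ∀ n N .{{_ : NonZero N}} i → ev n (𝕖 N i) ≡ scale N n
ev-𝕖 n N i = begin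
  ev n (𝕖 N i)
    ≡⟨ ev-* n (ofℝ (inverse ‖ 𝟙 N ‖₂ (‖𝟙‖₂-positive N))) 1ᶜ refl ⟩
  inv (√≈ n (seq (∑ℝ {N} (λ _ → ∣ 1ᶜ ∣²)) n)) * 1ℚ
    ≡⟨ *-identityʳ _ ⟩
  inv (√≈ n (seq (∑ℝ {N} (λ _ → ∣ 1ᶜ ∣²)) n))
    ≡⟨ cong (λ q → inv (√≈ n q)) (∑-ones N n) ⟩
  scale N n ∎
  where open ≡-Reasoning

real-𝕖 : ∀ n N .{{_ : NonZero N}} i → RealAt n (𝕖 N i)
real-𝕖 n N i = real-* n (ofℝ (inverse ‖ 𝟙 N ‖₂ (‖𝟙‖₂-positive N))) 1ᶜ refl refl

module _ (n : ℕ) {N : ℕ} .{{_ : NonZero N}} (B : Matrix N N) (real-B : ∀ i j → RealAt n (B i j)) where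

  private
    s = scale N n

    real-Be : ∀ i → RealAt n ((B *ᵛ 𝕖 N) i)
    real-Be i = real-∑ n _ λ j → real-* n (B i j) (𝕖 N j) (real-B i j) (real-𝕖 n N j)

    ev-Be : ∀ i → ev n ((B *ᵛ 𝕖 N) i) ≡ ∑ℚ (λ j → ev n (B i j)) * s
    ev-Be i = begin
      ev n ((B *ᵛ 𝕖 N) i)
        ≡⟨ ev-∑ n (λ j → B i j *ᶜ 𝕖 N j) ⟩
      ∑ℚ (λ j → ev n (B i j *ᶜ 𝕖 N j))
        ≡⟨ sum-cong-≗ (λ j → trans (ev-* n (B i j) (𝕖 N j) (real-B i j))
             (cong (ev n (B i j) *_) (ev-𝕖 n N j))) ⟩
      ∑ℚ (λ j → ev n (B i j) * s)
        ≡⟨ sym (*-distribʳ-sum s (λ j → ev n (B i j))) ⟩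
      ∑ℚ (λ j → ev n (B i j)) * s ∎
      where open ≡-Reasoning

    real-conj : ∀ i → RealAt n (conj (𝕖 N i))
    real-conj i = cong -_ (real-𝕖 n N i)

  real-φₑ : RealAt n (φₑ B)
  real-φₑ = real-∑ n _ λ i →
    real-* n (conj (𝕖 N i)) ((B *ᵛ 𝕖 N) i) (real-conj i) (real-Be i)

  ev-φₑ : ev n (φₑ B) ≡ ∑ℚ (λ i → ∑ℚ (λ j → ev n (B i j))) * sq s
  ev-φₑ = begin
    ev n (φₑ B)
      ≡⟨ ev-∑ n (λ i → conj (𝕖 N i) *ᶜ (B *ᵛ 𝕖 N) i) ⟩
    ∑ℚ (λ i → ev n (conj (𝕖 N i) *ᶜ (B *ᵛ 𝕖 N) i))
      ≡⟨ sum-cong-≗ term ⟩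
    ∑ℚ (λ i → row i * sq s)
      ≡⟨ sym (*-distribʳ-sum (sq s) row) ⟩
    ∑ℚ row * sq s ∎
    where
    open ≡-Reasoning
    row : Fin N → ℚ
    row i = ∑ℚ (λ j → ev n (B i j))

    term : ∀ i → ev n (conj (𝕖 N i) *ᶜ (B *ᵛ 𝕖 N) i) ≡ row i * sq s
    term i = trans (ev-* n (conj (𝕖 N i)) ((B *ᵛ 𝕖 N) i) (real-conj i))
      -- `ev-𝕖` also serves for the conjugate, since `conj` leaves the real part untouched.
      (trans (cong₂ _*_ (ev-𝕖 n N i) (ev-Be i))
        (solve 2 (λ s r → s :* (r :* s) := r :* (s :* s)) refl s (row i)))

-- Walks

edge : ∀ {a} {X : Set a} → Graph X → X → X → ℚ
edge G x y = indicator (does (Graph._~?_ G x y))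

-- The number of walks of length `k` from `x`. The argument is a vertex in `X`, not an index, so
-- that counts in the union and in a summand can be compared directly.
walks : ∀ {a} {X : Set a} → Graph X → ℕ → X → ℚ
walks G zero    x = 1ℚ
walks G (suc k) x = sumOver (λ y → edge G x y * walks G k y) (vertices G)

totalWalks : ∀ {a} {X : Set a} → Graph X → ℕ → ℚ
totalWalks G k = sumOver (walks G k) (vertices G)

module _ {a} {X : Set a} (G : Graph X) (n : ℕ) where

  private
    A = adjacency G
    V = vertices G

  real-adjacency : ∀ i j → RealAt n (A i j)
  real-adjacency i j = real-if n (does (Graph._~?_ G (lookup V i) (lookup V j)))

  row-sum : ∀ k i → ∑ℚ (λ j → ev n ((A ^ᴹ k) i j)) ≡ walks G k (lookup V i)
  row-sum zero i = begin
    ∑ℚ (λ j → ev n (if does (i Fin.≟ j) then 1ᶜ else 0ᶜ))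
      ≡⟨ sum-cong-≗ (λ j → ev-if n (does (i Fin.≟ j))) ⟩
    ∑ℚ (λ j → indicator (does (i Fin.≟ j)))
      ≡⟨ ∑-single _ i (λ j i≢j → cong indicator (dec-false (i Fin.≟ j) i≢j)) ⟩
    indicator (does (i Fin.≟ i))
      ≡⟨ cong indicator (dec-true (i Fin.≟ i) refl) ⟩
    1ℚ ∎
    where open ≡-Reasoning
  row-sum (suc k) i = begin
    ∑ℚ (λ j → ev n (∑ (λ l → A i l *ᶜ P l j)))
      ≡⟨ sum-cong-≗ (λ j → trans (ev-∑ n (λ l → A i l *ᶜ P l j))
           (sum-cong-≗ λ l → ev-* n (A i l) (P l j) (real-adjacency i l))) ⟩
    ∑ℚ (λ j → ∑ℚ (λ l → ev n (A i l) * ev n (P l j)))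
      -- Summing over the endpoint `j` first turns the inner sum into a row sum of `P`, to which the
      -- induction hypothesis applies.
      ≡⟨ ∑-comm (λ j l → ev n (A i l) * ev n (P l j)) ⟩
    ∑ℚ (λ l → ∑ℚ (λ j → ev n (A i l) * ev n (P l j)))
      ≡⟨ sum-cong-≗ (λ l → sym (*-distribˡ-sum (ev n (A i l)) (λ j → ev n (P l j)))) ⟩
    ∑ℚ (λ l → ev n (A i l) * ∑ℚ (λ j → ev n (P l j)))
      ≡⟨ sum-cong-≗ (λ l → cong₂ _*_ (ev-if n (does (Graph._~?_ G (lookup V i) (lookup V l)))) (row-sum k l)) ⟩
    walks G (suc k) (lookup V i) ∎
    where
    open ≡-Reasoning
    P = A ^ᴹ k

  module _ {m : ℕ} (i j : Fin (suc m)) where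

    real-moment : RealAt n (moment m G i j)
    real-moment = real-φₑ n {{Graph.nonempty G}} _ (real-^ n A real-adjacency (toℕ i ℕ.+ toℕ j))

    ev-moment : ev n (moment m G i j) ≡ totalWalks G (toℕ i ℕ.+ toℕ j) * sq (scale (order G) n)
    ev-moment = trans
      (ev-φₑ n {{Graph.nonempty G}} _ (real-^ n A real-adjacency (toℕ i ℕ.+ toℕ j)))
      (cong (_* sq (scale (order G) n)) (sum-cong-≗ (row-sum (toℕ i ℕ.+ toℕ j))))

-- Walks in a disjoint union

module _ {a} {X : Set a} {K} (G : Fin (suc K) → Graph X) (disjoint : MutuallyDisjoint G) where

  private
    V = λ j → vertices (G j)
    H = ⨆ G disjoint

  -- An edge of the union belongs to some `G l` and has `x` among the vertices of `G l`;
  -- disjointness forces `l` to be `j`.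
  edge-same : ∀ {j x y} → x ∈ V j → edge H x y ≡ edge (G j) x y
  edge-same {j} {x} {y} x∈ = cong indicator
    (does-⇔ (mk⇔ to (j ,_)) (Graph._~?_ H x y) (Graph._~?_ (G j) x y))
    where
    to : ∃ (λ l → Graph._~_ (G l) x y) → Graph._~_ (G j) x y
    to (l , e) with l Fin.≟ j
    ... | yes refl = e
    ... | no l≢j   = contradiction (Graph.~⇒∈ (G l) e , x∈) (disjoint l j l≢j)

  -- Such an edge would lie in `G j`, and by symmetry its other end `y` would be a vertex of both
  -- `G j` and `G l`.
  edge-distinct : ∀ {j l x y} → j ≢ l → x ∈ V j → y ∈ V l → edge H x y ≡ 0ℚ
  edge-distinct {j} {l} {x} {y} j≢l x∈ y∈ = trans (edge-same x∈)
    (cong indicator (dec-false (Graph._~?_ (G j) x y)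
      λ e → disjoint j l j≢l (Graph.~⇒∈ (G j) (Graph.~-sym (G j) e) , y∈)))

  -- The sum over the first step splits into one block per summand. Only block `j` survives, and the
  -- next vertex is again in `V j`, so the induction continues.
  walks-⨆ : ∀ k {j x} → x ∈ V j → walks H k x ≡ walks (G j) k x
  walks-⨆ zero    x∈ = refl
  walks-⨆ (suc k) {j} {x} x∈ = begin
    sumOver f (concat (tabulate V))
      ≡⟨ sumOver-concat f V ⟩
    ∑ℚ (λ l → sumOver f (V l))
      ≡⟨ ∑-single _ j (λ l j≢l → ∑-zero _ λ i → trans
           (cong (_* walks H k (lookup (V l) i)) (edge-distinct {y = lookup (V l) i} j≢l x∈ (∈-lookup {xs = V l} i)))
           (*-zeroˡ (walks H k (lookup (V l) i)))) ⟩
    sumOver f (V j)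
      ≡⟨ sumOver-cong (V j) (λ {y} y∈ → cong₂ _*_ (edge-same {y = y} x∈) (walks-⨆ k y∈)) ⟩
    walks (G j) (suc k) x ∎
    where
    open ≡-Reasoning
    f : X → ℚ
    f y = edge H x y * walks H k y

  totalWalks-⨆ : ∀ k → totalWalks H k ≡ ∑ℚ (λ j → totalWalks (G j) k)
  totalWalks-⨆ k = trans (sumOver-concat (walks H k) V)
    (sum-cong-≗ λ j → sumOver-cong (V j) (walks-⨆ k))

-- Limits

infix 4 _⟶_
-- Rational limits suffice: every moment is a rational number, and two reals with the same rational
-- limit are equal.
_⟶_ : (ℕ → ℚ) → ℚ → Set
s ⟶ q = ∀ ε → 0ℚ < ε → ∃ λ N → ∀ n → N ℕ.≤ n → Close ε (s n) q

⟶-cong : ∀ {s} t {p q} → (∀ n → t n ≡ s n) → q ≡ p → s ⟶ p → t ⟶ q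
⟶-cong t t≡s refl h ε 0<ε =
  let (N , k) = h ε 0<ε in N , λ n n≥ → subst (λ r → Close ε r _) (sym (t≡s n)) (k n n≥)

⟶⇒≈ℝ : ∀ x y {q} → seq x ⟶ q → seq y ⟶ q → x ≈ℝ y
⟶⇒≈ℝ x y {q} h k ε 0<ε =
  let (M , hx) = h (½ * ε) (half-pos 0<ε)
      (N , hy) = k (½ * ε) (half-pos 0<ε)
  in M ℕ.⊔ N , λ n n≥ →
     subst (λ η → Close η (seq x n) (seq y n)) (half-sum ε)
       (close-trans {p = seq x n} {q} {seq y n}
         (hx n (ℕ.m⊔n≤o⇒m≤o M N n≥))
         (close-sym {p = seq y n} {q} (hy n (ℕ.m⊔n≤o⇒n≤o M N n≥))))

⟶-+ : ∀ {s t p q} → s ⟶ p → t ⟶ q → (λ n → s n + t n) ⟶ p + q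
⟶-+ {s} {t} {p} {q} h k ε 0<ε =
  let (M , hs) = h (½ * ε) (half-pos 0<ε)
      (N , ht) = k (½ * ε) (half-pos 0<ε)
  in M ℕ.⊔ N , λ n n≥ →
     subst (λ η → Close η (s n + t n) (p + q)) (half-sum ε)
       (close-+ {p = s n} {p} {t n} {q}
         (hs n (ℕ.m⊔n≤o⇒m≤o M N n≥)) (ht n (ℕ.m⊔n≤o⇒n≤o M N n≥)))

⟶-∑ : ∀ {N} (s : Fin N → ℕ → ℚ) (q : Fin N → ℚ) → (∀ j → s j ⟶ q j) →
      (λ n → ∑ℚ (λ j → s j n)) ⟶ ∑ℚ q
⟶-∑ {zero}  s q h ε 0<ε = 0 , λ _ _ → close-refl 0ℚ (<⇒≤ 0<ε)
⟶-∑ {suc N} s q h =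
  ⟶-+ {s zero} {λ n → ∑ℚ (λ j → s (suc j) n)} (h zero) (⟶-∑ (s ∘ suc) (q ∘ suc) (h ∘ suc))

inv-pos : ∀ {q} → 0ℚ < q → 0ℚ < inv q
inv-pos {q} 0<q with q ≟ 0ℚ
... | yes q≡0 = contradiction (sym q≡0) (<⇒≢ 0<q)
... | no  q≢0 = recip-pos 0<q

*-inv-* : ∀ {q} → 0ℚ < q → ∀ r → q * (inv q * r) ≡ r
*-inv-* {q} 0<q r = trans
  (solve 3 (λ q u r → q :* (u :* r) := (u :* q) :* r) refl q (inv q) r)
  (trans (cong (_* r) (inv-inverse 0<q)) (*-identityˡ r))

-- Lets the limit of squared reciprocals be computed as the limit of reciprocals of squares.
inv-sq : ∀ {q} → 0ℚ < q → inv (sq q) ≡ sq (inv q)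
inv-sq {q} 0<q = begin
  inv (sq q)
    ≡⟨ sym (trans (cong (λ r → inv (sq q) * sq r) (inv-inverse 0<q)) (*-identityʳ (inv (sq q)))) ⟩
  inv (sq q) * sq (inv q * q)
    ≡⟨ solve 3 (λ q u v → v :* ((u :* q) :* (u :* q)) := (v :* (q :* q)) :* (u :* u)) refl q (inv q) (inv (sq q)) ⟩
  (inv (sq q) * sq q) * sq (inv q)
    ≡⟨ cong (_* sq (inv q)) (inv-inverse (*-pos 0<q 0<q)) ⟩
  1ℚ * sq (inv q)
    ≡⟨ *-identityˡ (sq (inv q)) ⟩
  sq (inv q) ∎
  where open ≡-Reasoning

⟶-* : ∀ c s {q} → s ⟶ q → (λ n → c * s n) ⟶ c * q
⟶-* c s {q} h ε 0<ε =
  let (N , k) = h (inv B * ε) (*-pos (inv-pos 0<B) 0<ε)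
  in N , λ n n≥ →
     subst (∣ c * s n - c * q ∣ ≤_) (*-inv-* 0<B ε)
       (solve 3 (λ c s q → c :* s :- c :* q := c :* (s :- q)) refl c (s n) q
        ⟵ ∣∣-* c (s n - q) c≤B (k n n≥))
  where
  -- The added 1 keeps `B` positive even when `c` is 0, so that `inv B` is a true reciprocal.
  B = ∣ c ∣ + 1ℚ
  c≤B : ∣ c ∣ ≤ B
  c≤B = p≤p+ ∣ c ∣ (nonNegative⁻¹ 1ℚ)
  0<B : 0ℚ < B
  0<B = +-mono-≤-< (0≤∣p∣ c) (positive⁻¹ 1ℚ)

⟶-inv : ∀ {s q c} → 0ℚ < c → (∃ λ N → ∀ n → N ℕ.≤ n → c ≤ s n) → c ≤ q →
        s ⟶ q → (inv ∘ s) ⟶ inv q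
⟶-inv {s} {q} {c} 0<c (M , lower) c≤q h ε 0<ε =
  -- On arguments at least `c`, `inv` is Lipschitz with constant `inv c * inv c`, so the tolerance
  -- c²ε becomes ε.
  let (N , k) = h (c * (c * ε)) (*-pos 0<c (*-pos 0<c 0<ε))
  in M ℕ.⊔ N , λ n n≥ →
     subst (λ η → Close η (inv (s n)) (inv q)) eq
       (inv-close 0<c (lower n (ℕ.m⊔n≤o⇒m≤o M N n≥)) c≤q (k n (ℕ.m⊔n≤o⇒n≤o M N n≥)))
  where
  eq : inv c * inv c * (c * (c * ε)) ≡ ε
  eq = trans (solve 3 (λ c u ε → u :* u :* (c :* (c :* ε)) := c :* (u :* (c :* (u :* ε)))) refl c (inv c) ε)
    (trans (*-inv-* 0<c (c * (inv c * ε))) (*-inv-* 0<c ε))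

-- Convergence of the approximate square roots

module _ (q : ℚ) (1≤q : 1ℚ ≤ q) where

  private
    0≤q : 0ℚ ≤ q
    0≤q = ≤-trans (nonNegative⁻¹ 1ℚ) 1≤q

    √²≤ : ∀ n → sq (√≈ n q) ≤ q
    √²≤ n with √-below n q
    ... | inj₁ √≡0 = subst (λ r → sq r ≤ q) (sym √≡0) 0≤q
    ... | inj₂ √²≤q = √²≤q

    -- The square of the left side is at most `q`, which is at most `q * q` because `q` is at least
    -- 1.
    √≤ : ∀ n → √≈ n q ≤ q
    √≤ n = sq-cancel 0≤q (≤-trans (√²≤ n)
      (subst (_≤ q * q) (*-identityʳ q) (*-monoˡ-≤-nonNeg q {{nonNegative 0≤q}} 1≤q)))

    B = q + q + 1ℚ

    0<B : 0ℚ < B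
    0<B = +-mono-≤-< (+-nonNeg 0≤q 0≤q) (positive⁻¹ 1ℚ)

    mesh≤1 : ∀ n → mesh n ≤ 1ℚ
    mesh≤1 n = mesh-anti {0} {n} ℕ.z≤n

    -- By `√-above`, `q` is at most (b + d)² = b² + (b + b + d) · d, and `B` bounds b + b + d
    -- because b ≤ q and d ≤ 1.
    q≤ : ∀ n → q ≤ sq (√≈ n q) + B * mesh n
    q≤ n = begin
      q                          ≤⟨ √-above n q ⟩
      sq (b + d)                 ≡⟨ solve 2 (λ b d → (b :+ d) :* (b :+ d) := b :* b :+ (b :+ b :+ d) :* d) refl b d ⟩
      sq b + (b + b + d) * d     ≤⟨ +-monoʳ-≤ (sq b) (*-monoʳ-≤-nonNeg d {{nonNegative (<⇒≤ (0<mesh n))}}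
                                      (+-mono-≤ (+-mono-≤ (√≤ n) (√≤ n)) (mesh≤1 n))) ⟩
      sq b + B * d               ∎
      where
      open ≤-Reasoning
      b = √≈ n q
      d = mesh n

    √²⟶ : (λ n → sq (√≈ n q)) ⟶ q
    √²⟶ ε 0<ε =
      let (N , small) = mesh-small (inv B * ε) (*-pos (inv-pos 0<B) 0<ε)
      in N , λ n n≥ → ≤⇒close
        (≤-trans (√²≤ n) (p≤p+ q (<⇒≤ 0<ε)))
        (≤-trans (q≤ n) (+-monoʳ-≤ (sq (√≈ n q))
          (subst (B * mesh n ≤_) (*-inv-* 0<B ε)
            (*-monoˡ-≤-nonNeg B {{nonNegative (<⇒≤ 0<B)}} (small n n≥)))))

  -- The root of `q` may be irrational, so the squares of its approximations, which tend to `q`, are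
  -- inverted instead.
  inv-√²⟶ : (λ n → sq (inv (√≈ n q))) ⟶ inv q
  inv-√²⟶ = limit (√-positive (fromℚ q) (λ _ → 1≤q))
    where
    limit : Positiveℝ (√ fromℚ q) → (λ n → sq (inv (√≈ n q))) ⟶ inv q
    limit (c , 0<c , M , lower) ε 0<ε =
      let (N , k) = ⟶-inv {λ n → sq (√≈ n q)} (*-pos 0<c 0<c)
            (M , λ n n≥ → sq-mono (<⇒≤ 0<c) (lower n n≥))
            -- The limit `q` obeys the same lower bound c², read off from the approximation at index
            -- `M`.
            (≤-trans (sq-mono (<⇒≤ 0<c) (lower M ℕ.≤-refl)) (√²≤ M)) √²⟶ ε 0<ε
      in M ℕ.⊔ N , λ n n≥ → subst (λ r → Close ε r (inv q))
           (inv-sq (<-≤-trans 0<c (lower n (ℕ.m⊔n≤o⇒m≤o M N n≥))))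
           (k n (ℕ.m⊔n≤o⇒n≤o M N n≥))

-- Moments as averages of walk numbers

1≤ι′ : ∀ N .{{_ : NonZero N}} → 1ℚ ≤ ι N
1≤ι′ (suc N) = 1≤ι N

0<ι : ∀ N .{{_ : NonZero N}} → 0ℚ < ι N
0<ι N = 1≤⇒0< (1≤ι′ N)

moment-⟶ : ∀ {a} {X : Set a} (G : Graph X) {m} (i j : Fin (suc m)) →
  (λ n → ev n (moment m G i j)) ⟶ totalWalks G (toℕ i ℕ.+ toℕ j) * inv (ι (order G))
moment-⟶ G i j = ⟶-cong (λ n → ev n (moment _ G i j)) (λ n → ev-moment G n i j) refl
  (⟶-* (totalWalks G (toℕ i ℕ.+ toℕ j)) (λ n → sq (scale (order G) n))
    (inv-√²⟶ (ι (order G)) (1≤ι′ (order G) {{Graph.nonempty G}})))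

-- Links the weights, written with `/`, to the limits, written with `inv`. As `/` reduces to lowest
-- terms, the equation is checked by cross-multiplying unnormalised fractions.
/-inv : ∀ m n .{{_ : NonZero n}} → ℤ.+ m / n ≡ ι m * inv (ι n)
/-inv m n@(suc n-1) = begin
  ℤ.+ m / n                       ≡⟨ sym (*-inv-* (0<ι n) (ℤ.+ m / n)) ⟩
  ι n * (inv (ι n) * (ℤ.+ m / n)) ≡⟨ solve 3 (λ n u r → n :* (u :* r) := (n :* r) :* u) refl (ι n) (inv (ι n)) (ℤ.+ m / n) ⟩
  ι n * (ℤ.+ m / n) * inv (ι n)   ≡⟨ cong (_* inv (ι n)) cancel ⟩
  ι m * inv (ι n)                 ∎
  where
  open ≡-Reasoning
  frac = ℚᵘ.mkℚᵘ (ℤ.+ m) n-1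
  cancel : ι n * (ℤ.+ m / n) ≡ ι m
  cancel = toℚᵘ-injective (ℚᵘ.≃-trans (toℚᵘ-homo-* (ι n) (ℤ.+ m / n))
    (ℚᵘ.≃-trans (ℚᵘ.*-congˡ {toℚᵘ (ι n)} (toℚᵘ-fromℚᵘ frac))
      (ℚᵘ.*≡* (trans (ℤ.*-identityʳ (ℤ.+ n ℤ.* ℤ.+ m))
        (trans (ℤ.*-comm (ℤ.+ n) (ℤ.+ m)) (cong (λ k → ℤ.+ m ℤ.* ℤ.+ k) (sym (ℕ.+-identityʳ n))))))))

-- The weighted average over the summands

module _ {a} {X : Set a} {K} (G : Fin (suc K) → Graph X) (disjoint : MutuallyDisjoint G) where

  private
    H = ⨆ G disjoint
    α = totalOrder G
    -- A weight is a constant sequence, so its term at 0 is its term at every index.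
    w = λ j → ev 0 (weight G j)

  -- Walk numbers add up over the summands, and in each term the numerator of the weight cancels the
  -- order of `G j`, leaving the common denominator `α`.
  average : ∀ k → totalWalks H k * inv (ι (order H)) ≡
                  ∑ℚ (λ j → w j * (totalWalks (G j) k * inv (ι (order (G j)))))
  average k = begin
    totalWalks H k * inv (ι (order H))
      ≡⟨ cong₂ (λ W N → W * inv (ι N)) (totalWalks-⨆ G disjoint k) (length-concat (λ j → vertices (G j))) ⟩
    ∑ℚ W * inv (ι α)
      ≡⟨ *-distribʳ-sum (inv (ι α)) W ⟩
    ∑ℚ (λ j → W j * inv (ι α))
      ≡⟨ sum-cong-≗ term ⟩
    ∑ℚ (λ j → w j * (W j * inv (ι (order (G j))))) ∎
    where
    open ≡-Reasoning
    W = λ j → totalWalks (G j) k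

    term : ∀ j → W j * inv (ι α) ≡ w j * (W j * inv (ι (order (G j))))
    term j = sym (begin
      w j * (W j * inv (ι αⱼ))
        ≡⟨ cong (_* (W j * inv (ι αⱼ))) (/-inv αⱼ α {{totalOrder-nonZero G}}) ⟩
      ι αⱼ * inv (ι α) * (W j * inv (ι αⱼ))
        ≡⟨ solve 4 (λ p q r s → p :* q :* (r :* s) := p :* (s :* (r :* q))) refl (ι αⱼ) (inv (ι α)) (W j) (inv (ι αⱼ)) ⟩
      ι αⱼ * (inv (ι αⱼ) * (W j * inv (ι α)))
        ≡⟨ *-inv-* (0<ι αⱼ {{Graph.nonempty (G j)}}) (W j * inv (ι α)) ⟩
      W j * inv (ι α) ∎)
      where αⱼ = order (G j)

  moment-⨆ : ∀ n → moment n H ≋ ∑ᴹ (λ j → weight G j · moment n (G j))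
  -- The real parts share a rational limit. The imaginary parts are 0 at every index, so the
  -- threshold 0 works for them.
  moment-⨆ n i j = ⟶⇒≈ℝ (re (moment n H i j)) (re (∑ term)) (moment-⟶ H i j) rhs , λ ε 0<ε → 0 , λ m _ →
    subst₂ (Close ε) (sym (real-moment H m i j)) (sym (real-rhs m)) (close-refl 0ℚ (<⇒≤ 0<ε))
    where
    term : Fin (suc K) → ℂ
    term l = weight G l *ᶜ moment n (G l) i j

    real-rhs : ∀ m → RealAt m (∑ term)
    real-rhs m = real-∑ m term λ l →
      real-* m (weight G l) (moment n (G l) i j) refl (real-moment (G l) m i j)

    rhs : seq (re (∑ term)) ⟶ totalWalks H (toℕ i ℕ.+ toℕ j) * inv (ι (order H))
    rhs = ⟶-cong (seq (re (∑ term)))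
      (λ m → trans (ev-∑ m term) (sum-cong-≗ λ l → ev-* m (weight G l) (moment n (G l) i j) refl))
      (average (toℕ i ℕ.+ toℕ j))
      (⟶-∑ (λ l m → w l * ev m (moment n (G l) i j))
           (λ l → w l * (totalWalks (G l) (toℕ i ℕ.+ toℕ j) * inv (ι (order (G l)))))
           λ l → ⟶-* (w l) (λ m → ev m (moment n (G l) i j)) (moment-⟶ (G l) i j))

theorem3p19 : ∀ {a} {X : Set a} (K : ℕ) {{_ : NonZero K}} (G : Fin K → Graph X)
    (disjoint : MutuallyDisjoint G) (n : ℕ) →
    moment n (⨆ G disjoint) ≋ ∑ᴹ (λ j → weight G j · moment n (G j))
theorem3p19 (suc K) G disjoint n = moment-⨆ G disjoint n
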